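{- Let $m$, $n$, and $t$ be positive integers, and let $G=\mathbb{Z}_n$ be the cyclic group of order $n$. 1. If $n=2$, then the set $\{1\}$ is a tight $1$-independent set in $G$. 2. If $n=2m+1$, then the set $\{1,2,\dots,m\}$ is a tight $2$-independent set in $G$. 3. If $n=4m$, then the set $\{1,3,\dots,2m-1\}$ is a tight $3$-independent set in $G$. 4. If $n=t+1$, then the set $\{1\}$ is a tight $t$-independent set in $G$. 5. Let $n=\lfloor t^2/2\rfloor+t+1$. If $t$ is even, then the set $\{t/2,\,t/2+1\}$ is a tight $t$-independent set in $G$; if $t$ is odd, then the set $\{1,t\}$ is a tight $t$-independent set in $G$. 6. If $n=38$, then the set $\{1,7,11\}$ is a tight $5$-independent set in $G$.
   Context: The numbers $a(m,s)$, for non-negative integers $m,s$, are defined recursively by $a(m,0)=a(0,s)=1$ and, for $m,s\ge 1$, $a(m,s)=a(m-1,s)+a(m,s-1)+a(m-1,s-1)$. For positive integers $m,t$ put $q(m,t)=a(m,t/2)$ if $t$ is even, and $q(m,t)=a(m,(t-1)/2)+a(m-1,(t-1)/2)$ if $t$ is odd. Let $G$ be a finite abelian group written additively and $A=\{a_1,\dots,a_m\}$ a subset of $G$ of size $m$. $A$ is a $t$-independent set in $G$ if, whenever $\lambda_1a_1+\cdots+\lambda_m a_m=0$ for some integers $\lambda_1,\dots,\lambda_m$ with $|\lambda_1|+\cdots+|\lambda_m|\le t$, we have $\lambda_1=\cdots=\lambda_m=0$. A $t$-independent set $A$ of size $m$ in $G$ is called a tight $t$-independent set in $G$ if $|G|=q(m,t)$.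 (Here the size of $A$ is its number of distinct elements; for $t=1$ the set $\{1,t\}$ is just $\{1\}$.) Integers are regarded as elements of $\mathbb{Z}_n$ via reduction modulo $n$. -}

module Defs where

open import Algebra.Bundles using (AbelianGroup)
open import Data.Bool.Base using (if_then_else_)
open import Data.Fin.Base using (Fin)
open import Data.Integer.Base as ℤ using (ℤ; +_; -[1+_]; ∣_∣; 0ℤ)
import Data.Integer.Properties as ℤ
open import Data.Integer.Divisibility.Signed
  using (∣m⇒∣-m; ∣m∣n⇒∣m+n) renaming (_∣_ to _∣ℤ_; divides to dividesℤ)
open import Data.Integer.Tactic.RingSolver using (solve-∀)
open import Data.List.Base using (List; map)
import Data.List.Membership.Setoid as Membership
open import Data.Nat.Base using (ℕ; zero; suc; _+_; _∸_; _≤_; _/_; NonZero; +-0-rawMonoid)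
open import Data.Nat.Divisibility using (_∣?_)
open import Data.Product.Base using (_,_; ∃)
open import Level using (0ℓ; _⊔_)
open import Relation.Binary.PropositionalEquality
  using (_≡_; refl; sym; subst)
open import Relation.Nullary.Decidable.Core using (does)
open import Relation.Unary using (Pred; U; _∈_)
import Algebra.Definitions.RawMonoid as RawMonoidDefs

a : ℕ → ℕ → ℕ
a zero    s       = 1
a (suc m) zero    = 1
a (suc m) (suc s) = a m (suc s) + a (suc m) s + a m s

q : (m t : ℕ) .{{_ : NonZero m}} .{{_ : NonZero t}} → ℕ
q m t = if does (2 ∣? t)
        then a m (t / 2)
        else a m ((t ∸ 1) / 2) + a (m ∸ 1) ((t ∸ 1) / 2)

sumℕ : ∀ {m} → (Fin m → ℕ) → ℕ
sumℕ = RawMonoidDefs.sum +-0-rawMonoid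

module _ {c ℓ} (G : AbelianGroup c ℓ) where

  open AbelianGroup G
    using (Carrier; _≈_; rawMonoid)
    renaming (ε to 0#; _⁻¹ to -_)
  open RawMonoidDefs rawMonoid using (sum) renaming (_×_ to _×ℕ_)

  infixr 8 _·_

  _·_ : ℤ → Carrier → Carrier
  (+ n)    · x = n ×ℕ x
  -[1+ n ] · x = - (suc n ×ℕ x)

  -- A listing without repetition of a subset of G, so that A has exactly
  -- k elements; the underlying setoid equality is the equality of G, and
  -- A is understood up to it.
  record Listing {p} (A : Pred Carrier p) (k : ℕ) : Set (c ⊔ ℓ ⊔ p) where
    field
      element    : Fin k → Carrier
      element∈   : ∀ i → element i ∈ A
      injective  : ∀ {i j} → element i ≈ element j → i ≡ j
      exhaustive : ∀ {x} → x ∈ A → ∃ λ i → x ≈ element i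

  record IsIndependent (t : ℕ) {p} (A : Pred Carrier p) (m : ℕ)
         : Set (c ⊔ ℓ ⊔ p) where
    field
      listing : Listing A m
    open Listing listing public
    field
      independent : (λs : Fin m → ℤ) →
                    sumℕ (λ i → ∣ λs i ∣) ≤ t →
                    sum (λ i → λs i · element i) ≈ 0# →
                    ∀ i → λs i ≡ 0ℤ

  record IsTightIndependent (t : ℕ) .{{_ : NonZero t}} {p} (A : Pred Carrier p)
         : Set (c ⊔ ℓ ⊔ p) where
    field
      size          : ℕ
      .{{positive}} : NonZero size
      isIndependent : IsIndependent t A size
      order         : Listing U (q size t)

-- A record rather than a synonym so that x and y can be inferred.
record _≡_[mod_] (x y : ℤ) (n : ℕ) : Set where
  constructor congruent
  field
    n∣x-y : + n ∣ℤ (x ℤ.- y)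

-- The cyclic group of order n for n > 0, as the setoid of integers under
-- congruence; the reduction of an integer modulo n is that integer itself.
ℤ/ : ℕ → AbelianGroup 0ℓ 0ℓ
ℤ/ n = record
  { Carrier = ℤ
  ; _≈_     = _≡_[mod n ]
  ; _∙_     = ℤ._+_
  ; ε       = 0ℤ
  ; _⁻¹     = ℤ.-_
  ; isAbelianGroup = record
    { isGroup = record
      { isMonoid = record
        { isSemigroup = record
          { isMagma = record
            { isEquivalence = record
              { refl  = ≡⇒≈ refl
              ; sym   = λ {x} {y} (congruent p) →
                  congruent (subst (+ n ∣ℤ_) (neg-diff x y) (∣m⇒∣-m p))
              ; trans = λ {x} {y} {z} (congruent p) (congruent r) →
                  congruent (subst (+ n ∣ℤ_) (add-diff x y z) (∣m∣n⇒∣m+n p r))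
              }
            ; ∙-cong = λ {x} {y} {u} {v} (congruent p) (congruent r) →
                congruent (subst (+ n ∣ℤ_) (sum-diff x y u v) (∣m∣n⇒∣m+n p r))
            }
          ; assoc = λ x y z → ≡⇒≈ (ℤ.+-assoc x y z)
          }
        ; identity = (λ x → ≡⇒≈ (ℤ.+-identityˡ x))
                   , (λ x → ≡⇒≈ (ℤ.+-identityʳ x))
        }
      ; inverse = (λ x → ≡⇒≈ (ℤ.+-inverseˡ x))
                , (λ x → ≡⇒≈ (ℤ.+-inverseʳ x))
      ; ⁻¹-cong = λ {x} {y} (congruent p) →
          congruent (subst (+ n ∣ℤ_) (diff-neg x y) (∣m⇒∣-m p))
      }
    ; comm = λ x y → ≡⇒≈ (ℤ.+-comm x y)
    }
  }
  where
  ≡⇒≈ : ∀ {x y} → x ≡ y → x ≡ y [mod n ]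
  ≡⇒≈ {x} refl = congruent (dividesℤ 0ℤ (ℤ.+-inverseʳ x))

  neg-diff : ∀ x y → ℤ.- (x ℤ.- y) ≡ y ℤ.- x
  neg-diff = solve-∀

  add-diff : ∀ x y z → (x ℤ.- y) ℤ.+ (y ℤ.- z) ≡ x ℤ.- z
  add-diff = solve-∀

  sum-diff : ∀ x y u v →
             (x ℤ.- y) ℤ.+ (u ℤ.- v) ≡ (x ℤ.+ u) ℤ.- (y ℤ.+ v)
  sum-diff = solve-∀

  diff-neg : ∀ x y → ℤ.- (x ℤ.- y) ≡ (ℤ.- x) ℤ.- (ℤ.- y)
  diff-neg = solve-∀

-- The subset of ℤ/ n consisting of the residues of the listed numbers.
-- Repetitions, also modulo n, do not matter.
residues : (n : ℕ) → List ℕ → Pred ℤ 0ℓ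
residues n xs = λ x → x ∈ₙ map +_ xs
  where open Membership (AbelianGroup.setoid (ℤ/ n)) renaming (_∈_ to _∈ₙ_)

{-# OPTIONS --safe #-}

-- A relation of weight at most t between residues ≤ M has an integer value of
-- absolute value at most t M. When t M < n the value is therefore 0, and only
-- relations over ℤ remain to be excluded; for n = 4 m a parity argument first
-- lowers the weight from 3 to 2. For {1, t} with t odd only t² < 2 n holds, so
-- the values ± n have to be excluded as well. The set {1, 7, 11} is settled by
-- running through all relations of weight at most 5.
module Submission where

open import Defs
open import Data.Nat.Base using (ℕ; suc; _+_; _*_; _^_; _/_; NonZero)
open import Data.Nat.Divisibility using (_∣_)
open import Data.List.Base using ([]; _∷_; map; upTo)
open import Data.Product.Base using (_×_)
open import Relation.Binary.PropositionalEquality using (_≡_)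
open import Relation.Nullary using (¬_)

open import Data.Bool.Base using (if_then_else_)
open import Data.Empty using (⊥; ⊥-elim)
open import Data.Fin.Base using (Fin; zero; suc; toℕ; fromℕ<; punchIn)
import Data.Fin.Properties as Fin
open import Data.Integer.Base as ℤ using (ℤ; +_; -[1+_]; ∣_∣; 0ℤ)
open import Data.Integer.Divisibility.Signed as ℤ∣ using () renaming (_∣_ to _∣ℤ_)
open import Data.Integer.DivMod using (_%ℕ_; _/ℕ_; n%ℕd<d; a≡a%ℕn+[a/ℕn]*n)
import Data.Integer.Properties as ℤ
open import Data.Integer.Tactic.RingSolver using () renaming (solve-∀ to solve-∀ℤ)
open import Data.List.Base using (List; lookup)
open import Data.List.Membership.Propositional using (_∈_; find; lose)
open import Data.List.Membership.Propositional.Properties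
  using (∈-lookup; ∈-map⁺; ∈-map⁻; ∈-upTo⁺; ∈-upTo⁻)
open import Data.List.Relation.Unary.Any using (index; here; there)
open import Data.List.Relation.Unary.Any.Properties using (lookup-index; map⁺; map⁻)
open import Data.Nat.Base
  using (zero; _≤_; _<_; _%_; _∸_; z≤n; s≤s; z<s; s<s; >-nonZero⁻¹; ≢-nonZero⁻¹)
open import Data.Nat.Divisibility using (divides; _∣?_; >⇒∤)
open import Data.Nat.DivMod using (m≡m%n+[m/n]*n; m%n<n; m*n/n≡m; +-distrib-/-∣ʳ)
import Data.Nat.Properties as ℕ
open import Data.Nat.Tactic.RingSolver using (solve-∀)
open import Data.Product.Base using (_,_; ∃; proj₁; proj₂)
open import Data.Sum.Base using (_⊎_; inj₁; inj₂)
open import Data.Unit.Base using (tt)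
open import Function.Base using (_∘_; _$_)
open import Function.Definitions using (Injective)
open import Relation.Binary.PropositionalEquality
  using (_≢_; refl; sym; trans; cong; cong₂; subst; subst₂; module ≡-Reasoning)
open import Relation.Nullary.Decidable
  using (Dec; map′; dec-true; dec-false; toWitness; _×-dec_; _→-dec_)
open import Relation.Nullary.Negation using (contradiction)
open import Relation.Unary using (Pred; U; Decidable)
open import Algebra.Properties.CommutativeMonoid.Sum ℤ.+-0-commutativeMonoid
  using (sum; sum-cong-≗; sum-remove)
import Algebra.Properties.CommutativeMonoid.Sum ℕ.+-0-commutativeMonoid as ℕΣ

-- Integer relations and their weight.

combination : ∀ {m} → (Fin m → ℤ) → (Fin m → ℕ) → ℤ
combination c f = sum (λ i → c i ℤ.* + f i)

weight : ∀ {m} → (Fin m → ℤ) → ℕ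
weight c = sumℕ (λ i → ∣ c i ∣)

-- Independence of the residues of `f` in `ℤ/ n`, restated over the integers: a sum vanishes in the
-- group exactly when the integer combination is divisible by `n`.
RelationFree : ∀ {m} → ℕ → ℕ → (Fin m → ℕ) → Set
RelationFree n t f =
  ∀ c → weight c ≤ t → + n ∣ℤ combination c f → ∀ i → c i ≡ 0ℤ

-- Cyclic groups

small-multiple : ∀ {n x} → + n ∣ℤ x → ∣ x ∣ < n → x ≡ 0ℤ
small-multiple {n} {x} n∣x x<n with ∣ x ∣ in eq
... | zero  = ℤ.∣i∣≡0⇒i≡0 eq
... | suc k = contradiction (subst (n ∣_) eq (ℤ∣.∣⇒∣ᵤ n∣x)) (>⇒∤ x<n)

reduced-injective : ∀ {n x y} → x < n → y < n → (+ x) ≡ (+ y) [mod n ] → x ≡ y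
reduced-injective {n} {x} {y} x<n y<n (congruent p) =
  ℤ.+-injective (ℤ.i-j≡0⇒i≡j (+ x) (+ y) (small-multiple p bound))
  where
  bound : ∣ + x ℤ.- + y ∣ < n
  bound rewrite ℤ.m-n≡m⊖n x y =
    ℕ.≤-<-trans (ℤ.∣m⊝n∣≤m⊔n x y) (ℕ.⊔-lub x<n y<n)

universe-listing : ∀ n .{{_ : NonZero n}} → Listing (ℤ/ n) U n
universe-listing n = record
  { element    = λ i → + toℕ i
  ; element∈   = λ _ → tt
  ; injective  = λ {i} {j} p →
      Fin.toℕ-injective (reduced-injective (Fin.toℕ<n i) (Fin.toℕ<n j) p)
  ; exhaustive = λ {x} _ → fromℕ< (n%ℕd<d x n) , congruent (ℤ∣.divides (x /ℕ n) (remainder x))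
  }
  where
  cancel : ∀ r b → (r ℤ.+ b) ℤ.- r ≡ b
  cancel = solve-∀ℤ

  remainder : ∀ x → x ℤ.- + toℕ (fromℕ< (n%ℕd<d x n)) ≡ (x /ℕ n) ℤ.* + n
  remainder x rewrite Fin.toℕ-fromℕ< (n%ℕd<d x n) =
    trans (cong (ℤ._- + (x %ℕ n)) (a≡a%ℕn+[a/ℕn]*n x n)) (cancel (+ (x %ℕ n)) _)

-- Entries below `n` remain distinct modulo `n`, so the subset has as many elements as `f` has
-- indices.
residues-listing : ∀ {n m} {xs : List ℕ} (f : Fin m → ℕ) →
  (∀ i → f i ∈ xs) → (∀ {v} → v ∈ xs → ∃ λ i → v ≡ f i) →
  Injective _≡_ _≡_ f → (∀ i → f i < n) →
  Listing (ℤ/ n) (residues n xs) m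
residues-listing {n} f f∈ onto inj f<n = record
  { element    = λ i → + f i
  ; element∈   = λ i → map⁺ (lose (f∈ i) (congruent (ℤ∣.divides 0ℤ (ℤ.+-inverseʳ (+ f i)))))
  ; injective  = λ {i} {j} p → inj (reduced-injective (f<n i) (f<n j) p)
  ; exhaustive = λ x∈ → exhaust (find (map⁻ x∈))
  }
  where
  exhaust : ∀ {x} → (∃ λ v → v ∈ _ × x ≡ (+ v) [mod n ]) → ∃ λ i → x ≡ (+ f i) [mod n ]
  exhaust (v , v∈ , p) with onto v∈
  ... | i , refl = i , p

-- The multiple in `ℤ/ n` is an iterated sum or its negative. On representatives it is the integer
-- product itself, not merely a congruent number, so it can be rewritten inside a sum.
·-* : ∀ n c x → _·_ (ℤ/ n) c x ≡ c ℤ.* x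
·-* n c x = by-sign c
  where
  nonneg : ∀ k → _·_ (ℤ/ n) (+ k) x ≡ + k ℤ.* x
  nonneg zero    = sym (ℤ.*-zeroˡ x)
  nonneg (suc k) = trans (cong (λ y → x ℤ.+ y) (nonneg k)) (sym (ℤ.suc-* (+ k) x))

  by-sign : ∀ c → _·_ (ℤ/ n) c x ≡ c ℤ.* x
  by-sign (+ k)    = nonneg k
  by-sign -[1+ k ] = trans (cong ℤ.-_ (nonneg (suc k))) (ℤ.neg-distribˡ-* (+ suc k) x)

-- Reduces each claim to a value of `q` and a statement on divisibility of integer combinations.
tight : ∀ {n m t} .{{_ : NonZero n}} .{{_ : NonZero m}} .{{_ : NonZero t}}
  {xs : List ℕ} (f : Fin m → ℕ) →
  (∀ i → f i ∈ xs) → (∀ {v} → v ∈ xs → ∃ λ i → v ≡ f i) →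
  Injective _≡_ _≡_ f → (∀ i → f i < n) →
  q m t ≡ n → RelationFree n t f →
  IsTightIndependent (ℤ/ n) t (residues n xs)
tight {n} {m} {t} f f∈ onto inj f<n q≡n free = record
  { size          = m
  ; isIndependent = record
    { listing     = residues-listing f f∈ onto inj f<n
    ; independent = λ c w≤t (congruent p) → free c w≤t $
        -- Congruence to zero is divisibility of the sum minus `0ℤ`; this subtraction is removed
        -- before the terms are rewritten as products.
        subst (+ n ∣ℤ_)
          (trans (ℤ.+-identityʳ _) (sum-cong-≗ (λ i → ·-* n (c i) (+ f i)))) p
    }
  ; order         = subst (Listing (ℤ/ n) U) (sym q≡n) (universe-listing n)
  }

-- Values of a and q

a[1,s] : ∀ s → a 1 s ≡ 1 + s * 2
a[1,s] zero = refl
a[1,s] (suc s) rewrite a[1,s] s = lemma s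
  where
  lemma : ∀ s → 1 + (1 + s * 2) + 1 ≡ 1 + (1 + s) * 2
  lemma = solve-∀

-- The centred square numbers 2s² + 2s + 1, written in the form of the modulus that belongs to
-- two-element sets with `t` even.
a[2,s] : ∀ s → a 2 s ≡ 1 + (s * s + s) * 2
a[2,s] zero = refl
a[2,s] (suc s) rewrite a[2,s] s | a[1,s] s = lemma s
  where
  lemma : ∀ s → 1 + (1 + s * 2) + 1 + (1 + (s * s + s) * 2) + (1 + s * 2)
              ≡ 1 + ((1 + s) * (1 + s) + (1 + s)) * 2
  lemma = solve-∀

a[m,0] : ∀ m → a m 0 ≡ 1
a[m,0] zero    = refl
a[m,0] (suc _) = refl

a[m,1] : ∀ m → a m 1 ≡ 2 * m + 1
a[m,1] zero = refl
a[m,1] (suc m) rewrite a[m,1] m | a[m,0] m = lemma m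
  where
  lemma : ∀ m → 2 * m + 1 + 1 + 1 ≡ 2 * (1 + m) + 1
  lemma = solve-∀

-- The parity test inside `q` does not evaluate for a variable `s`, so its outcome is supplied by an
-- explicit divisibility proof before the branch is taken.
q-even : ∀ m s .{{_ : NonZero m}} .{{_ : NonZero (s * 2)}} → q m (s * 2) ≡ a m s
q-even m s =
  trans (cong (λ b → if b then a m (s * 2 / 2) else a m ((s * 2 ∸ 1) / 2) + a (m ∸ 1) ((s * 2 ∸ 1) / 2))
              (dec-true (2 ∣? s * 2) (divides s refl)))
        (cong (a m) (m*n/n≡m s 2))

2∤1+s*2 : ∀ s → ¬ 2 ∣ suc (s * 2)
2∤1+s*2 s (divides k eq) = ℕ.even≢odd k s $
  trans (ℕ.*-comm 2 k) (trans (sym eq) (cong suc (ℕ.*-comm s 2)))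

q-odd : ∀ m s .{{_ : NonZero m}} → q m (suc (s * 2)) ≡ a m s + a (m ∸ 1) s
q-odd m s =
  trans (cong (λ b → if b then a m (suc (s * 2) / 2) else a m (s * 2 / 2) + a (m ∸ 1) (s * 2 / 2))
              (dec-false (2 ∣? suc (s * 2)) (2∤1+s*2 s)))
        (cong (λ k → a m k + a (m ∸ 1) k) (m*n/n≡m s 2))

even⊎odd : ∀ t → (∃ λ s → t ≡ s * 2) ⊎ (∃ λ s → t ≡ suc (s * 2))
even⊎odd t with t % 2 in eq | m≡m%n+[m/n]*n t 2 | m%n<n t 2
... | 0 | p | _ = inj₁ (t / 2 , p)
... | 1 | p | _ = inj₂ (t / 2 , p)
... | suc (suc _) | _ | s<s (s<s ())

q[1,t] : ∀ t .{{_ : NonZero t}} → q 1 t ≡ t + 1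
q[1,t] t with even⊎odd t
... | inj₁ (s , refl) = trans (q-even 1 s) (trans (a[1,s] s) (ℕ.+-comm 1 _))
... | inj₂ (s , refl) =
  -- The second summand of the odd case is `a 0 s`, which is 1 by definition.
  trans (q-odd 1 s) (cong (_+ 1) (a[1,s] s))

-- Integer combinations

∣combination∣≤ : ∀ {m} M (c : Fin m → ℤ) {f : Fin m → ℕ} → (∀ i → f i ≤ M) →
  ∣ combination c f ∣ ≤ weight c * M
∣combination∣≤ {zero}  M c f≤M = z≤n
∣combination∣≤ {suc m} M c {f} f≤M = begin
  ∣ x ℤ.+ R ∣                             ≤⟨ ℤ.∣i+j∣≤∣i∣+∣j∣ x R ⟩
  ∣ x ∣ + ∣ R ∣                           ≡⟨ cong (_+ ∣ R ∣) (ℤ.abs-* (c zero) (+ f zero)) ⟩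
  ∣ c zero ∣ * f zero + ∣ R ∣             ≤⟨ ℕ.+-mono-≤ (ℕ.*-monoʳ-≤ ∣ c zero ∣ (f≤M zero))
                                                         (∣combination∣≤ M (c ∘ suc) (f≤M ∘ suc)) ⟩
  ∣ c zero ∣ * M + weight (c ∘ suc) * M   ≡⟨ ℕ.*-distribʳ-+ M ∣ c zero ∣ _ ⟨
  weight c * M                            ∎
  where
  open ℕ.≤-Reasoning
  x = c zero ℤ.* + f zero
  R = combination (c ∘ suc) (f ∘ suc)

small-combination : ∀ {n t m} M {f : Fin m → ℕ} (c : Fin m → ℤ) →
  (∀ i → f i ≤ M) → t * M < n →
  weight c ≤ t → + n ∣ℤ combination c f → combination c f ≡ 0ℤ
small-combination M c f≤M tM<n w≤t n∣ = small-multiple n∣ $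
  ℕ.≤-<-trans (ℕ.≤-trans (∣combination∣≤ M c f≤M) (ℕ.*-monoˡ-≤ M w≤t)) tM<n

term≤sum : ∀ {m} (f : Fin m → ℕ) i → f i ≤ sumℕ f
term≤sum f zero    = ℕ.m≤m+n _ _
term≤sum f (suc i) = ℕ.≤-trans (term≤sum (f ∘ suc) i) (ℕ.m≤n+m _ _)

-- All `f i` are bounded by their total, so the absolute value is at most zero times that total.
weight≡0⇒combination≡0 : ∀ {m} (c : Fin m → ℤ) f → weight c ≡ 0 → combination c f ≡ 0ℤ
weight≡0⇒combination≡0 c f w≡0 = ℤ.∣i∣≡0⇒i≡0 $ ℕ.n≤0⇒n≡0 $
  ℕ.≤-trans (∣combination∣≤ (sumℕ f) c (term≤sum f)) (ℕ.≤-reflexive (cong (_* sumℕ f) w≡0))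

weight≡0⊎nonzero : ∀ {m} (c : Fin m → ℤ) → weight c ≡ 0 ⊎ ∃ λ i → 0 < ∣ c i ∣
weight≡0⊎nonzero {zero} c = inj₁ refl
weight≡0⊎nonzero {suc m} c with ∣ c zero ∣ in eq | weight≡0⊎nonzero (c ∘ suc)
... | suc k | _            = inj₂ (zero , subst (0 <_) (sym eq) z<s)
... | zero  | inj₁ w≡0     = inj₁ w≡0
... | zero  | inj₂ (i , p) = inj₂ (suc i , p)

weight-remove : ∀ {m} i (c : Fin (suc m) → ℤ) → weight c ≡ ∣ c i ∣ + weight (c ∘ punchIn i)
weight-remove i c = ℕΣ.sum-remove {i = i} (λ i → ∣ c i ∣)

combination-remove : ∀ {m} i (c : Fin (suc m) → ℤ) f →
  combination c f ≡ c i ℤ.* + f i ℤ.+ combination (c ∘ punchIn i) (f ∘ punchIn i)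
combination-remove i c f = sum-remove {i = i} (λ i → c i ℤ.* + f i)

-- The nonzero coefficient exhausts the weight, which leaves weight zero for all other terms.
single-term : ∀ {m} (c : Fin m → ℤ) f i → weight c ≤ 1 → 0 < ∣ c i ∣ →
  ∣ c i ∣ ≡ 1 × combination c f ≡ c i ℤ.* + f i
single-term {suc m} c f i w≤1 cᵢ>0 with split (subst (_≤ 1) (weight-remove i c) w≤1) cᵢ>0
  where
  split : ∀ {x w} → x + w ≤ 1 → 0 < x → x ≡ 1 × w ≡ 0
  split {suc zero} (s≤s w≤0) _ = refl , ℕ.n≤0⇒n≡0 w≤0
  split {suc (suc _)} (s≤s ()) _
... | ∣cᵢ∣≡1 , w≡0 = ∣cᵢ∣≡1 , (begin
  combination c f                                 ≡⟨ combination-remove i c f ⟩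
  c i ℤ.* + f i ℤ.+ combination (c ∘ punchIn i) _ ≡⟨ cong (λ y → c i ℤ.* + f i ℤ.+ y)
                                                       (weight≡0⇒combination≡0 (c ∘ punchIn i) (f ∘ punchIn i) w≡0) ⟩
  c i ℤ.* + f i ℤ.+ 0ℤ                            ≡⟨ ℤ.+-identityʳ _ ⟩
  c i ℤ.* + f i                                   ∎)
  where open ≡-Reasoning

-- If `c i` is nonzero, the other terms have weight at most 1. When that weight is 0,
-- `∣ c i ∣ * f i` would vanish, against positivity. Otherwise `c i` and one other coefficient are ±
-- 1, and comparing absolute values gives equal values of `f` at different indices.
combination≡0⇒free : ∀ {m} {f : Fin m → ℕ} → (∀ i → 0 < f i) → Injective _≡_ _≡_ f →
  ∀ c → weight c ≤ 2 → combination c f ≡ 0ℤ → ∀ i → c i ≡ 0ℤ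
combination≡0⇒free {suc m} {f} f>0 inj c w≤2 S≡0 i with ∣ c i ∣ in ∣cᵢ∣
... | zero  = ℤ.∣i∣≡0⇒i≡0 ∣cᵢ∣
... | suc k = ⊥-elim (impossible (weight≡0⊎nonzero r))
  where
  r = c ∘ punchIn i

  cᵢ>0 : 0 < ∣ c i ∣
  cᵢ>0 = subst (0 <_) (sym ∣cᵢ∣) z<s

  w-split : ∣ c i ∣ + weight r ≤ 2
  w-split = subst (_≤ 2) (weight-remove i c) w≤2

  ∣cᵢfᵢ∣≡∣rest∣ : ∣ c i ∣ * f i ≡ ∣ combination r (f ∘ punchIn i) ∣
  ∣cᵢfᵢ∣≡∣rest∣ = begin
    ∣ c i ∣ * f i                              ≡⟨ ℤ.abs-* (c i) (+ f i) ⟨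
    ∣ c i ℤ.* + f i ∣                          ≡⟨ cong ∣_∣ (negate (c i ℤ.* + f i) _
                                                    (trans (sym (combination-remove i c f)) S≡0)) ⟩
    ∣ ℤ.- combination r (f ∘ punchIn i) ∣      ≡⟨ ℤ.∣-i∣≡∣i∣ (combination r _) ⟩
    ∣ combination r (f ∘ punchIn i) ∣          ∎
    where
    open ≡-Reasoning
    isolate : ∀ x y → x ≡ (x ℤ.+ y) ℤ.- y
    isolate = solve-∀ℤ

    negate : ∀ x y → x ℤ.+ y ≡ 0ℤ → x ≡ ℤ.- y
    negate x y p = trans (isolate x y) (trans (cong (ℤ._- y) p) (ℤ.+-identityˡ _))

  both-one : ∀ {x w} → x + w ≤ 2 → 0 < x → 0 < w → x ≡ 1 × w ≤ 1
  both-one {suc zero} (s≤s w≤1) _ _ = refl , w≤1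
  both-one {suc (suc zero)} {suc _} (s≤s (s≤s ())) _ _
  both-one {suc (suc (suc _))} (s≤s (s≤s ())) _ _

  impossible : weight r ≡ 0 ⊎ (∃ λ j → 0 < ∣ r j ∣) → ⊥
  impossible (inj₁ w≡0) = ℕ.<⇒≢ (ℕ.*-mono-≤ cᵢ>0 (f>0 i)) $ sym $
    trans ∣cᵢfᵢ∣≡∣rest∣ (cong ∣_∣ (weight≡0⇒combination≡0 r _ w≡0))
  impossible (inj₂ (j , rⱼ>0))
    with both-one w-split cᵢ>0 (ℕ.≤-trans rⱼ>0 (term≤sum (λ j → ∣ r j ∣) j))
  ... | ∣cᵢ∣≡1 , w≤1 with single-term r (f ∘ punchIn i) j w≤1 rⱼ>0
  ... | ∣rⱼ∣≡1 , rest≡ = Fin.punchInᵢ≢i i j $ sym $ inj $ begin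
    f i                              ≡⟨ ℕ.*-identityˡ _ ⟨
    1 * f i                          ≡⟨ cong (_* f i) ∣cᵢ∣≡1 ⟨
    ∣ c i ∣ * f i                    ≡⟨ ∣cᵢfᵢ∣≡∣rest∣ ⟩
    ∣ combination r _ ∣              ≡⟨ cong ∣_∣ rest≡ ⟩
    ∣ r j ℤ.* + f (punchIn i j) ∣    ≡⟨ ℤ.abs-* (r j) (+ f (punchIn i j)) ⟩
    ∣ r j ∣ * f (punchIn i j)        ≡⟨ cong (_* f (punchIn i j)) ∣rⱼ∣≡1 ⟩
    1 * f (punchIn i j)              ≡⟨ ℕ.*-identityˡ _ ⟩
    f (punchIn i j)                  ∎
    where open ≡-Reasoning

-- Modulo 2 an odd factor acts as 1 and an integer agrees with its absolute value, so value and
-- weight of a relation between odd numbers have the same parity.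
odd-combination : ∀ {m} (c : Fin m → ℤ) (g : Fin m → ℕ) →
  + 2 ∣ℤ combination c (λ i → 2 * g i + 1) ℤ.- + weight c
odd-combination {zero}  c g = ℤ∣.divides 0ℤ refl
odd-combination {suc m} c g = subst (+ 2 ∣ℤ_) (regroup
  (c zero ℤ.* + (2 * g zero + 1)) (combination (c ∘ suc) (λ i → 2 * g (suc i) + 1))
  (+ ∣ c zero ∣) (+ weight (c ∘ suc))) $
  ℤ∣.∣m∣n⇒∣m+n term (odd-combination (c ∘ suc) (g ∘ suc))
  where
  regroup : ∀ x y u v → (x ℤ.- u) ℤ.+ (y ℤ.- v) ≡ (x ℤ.+ y) ℤ.- (u ℤ.+ v)
  regroup = solve-∀ℤ

  even⁺ : ∀ x y → x ℤ.* (+ 2 ℤ.* y ℤ.+ + 1) ℤ.- x ≡ x ℤ.* y ℤ.* + 2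
  even⁺ = solve-∀ℤ

  even⁻ : ∀ x y → x ℤ.* (+ 2 ℤ.* y ℤ.+ + 1) ℤ.- (ℤ.- x) ≡ (x ℤ.* y ℤ.+ x) ℤ.* + 2
  even⁻ = solve-∀ℤ

  term : + 2 ∣ℤ c zero ℤ.* + (2 * g zero + 1) ℤ.- + ∣ c zero ∣
  -- For c ≥ 0 the difference is c(2g + 1) - c = 2cg; for c ≤ 0 it is c(2g + 1) + c = 2(cg + c).
  term with ℤ.+∣i∣≡i⊎+∣i∣≡-i (c zero)
  ... | inj₁ eq = ℤ∣.divides (c zero ℤ.* + g zero) (trans
    (cong₂ (λ u v → c zero ℤ.* (u ℤ.+ + 1) ℤ.- v) (ℤ.pos-* 2 (g zero)) eq) (even⁺ (c zero) (+ g zero)))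
  ... | inj₂ eq = ℤ∣.divides (c zero ℤ.* + g zero ℤ.+ c zero) (trans
    (cong₂ (λ u v → c zero ℤ.* (u ℤ.+ + 1) ℤ.- v) (ℤ.pos-* 2 (g zero)) eq) (even⁻ (c zero) (+ g zero)))

-- Tight independent sets

∈-tabulated⁺ : ∀ {m} (h : ℕ → ℕ) (i : Fin m) → h (toℕ i) ∈ map h (upTo m)
∈-tabulated⁺ h i = ∈-map⁺ h (∈-upTo⁺ (Fin.toℕ<n i))

∈-tabulated⁻ : ∀ {m v} (h : ℕ → ℕ) → v ∈ map h (upTo m) → ∃ λ (i : Fin m) → v ≡ h (toℕ i)
∈-tabulated⁻ h v∈ with ∈-map⁻ h v∈
... | k , k∈ , refl = fromℕ< (∈-upTo⁻ k∈) , cong h (sym (Fin.toℕ-fromℕ< (∈-upTo⁻ k∈)))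

∈-lookup⁻ : ∀ {v} (xs : List ℕ) → v ∈ xs → ∃ λ i → v ≡ lookup xs i
∈-lookup⁻ xs v∈ = index v∈ , lookup-index v∈

tight₂ : ∀ m .{{_ : NonZero m}} .{{_ : NonZero (2 * m + 1)}} →
  IsTightIndependent (ℤ/ (2 * m + 1)) 2 (residues (2 * m + 1) (map (λ i → i + 1) (upTo m)))
tight₂ m = tight (λ i → toℕ i + 1)
  (∈-tabulated⁺ (_+ 1)) (∈-tabulated⁻ (_+ 1)) inj
  (λ i → ℕ.≤-<-trans (f≤m i) (ℕ.≤-<-trans (ℕ.m≤m+n m _) 2m<n))
  -- For the numeral 2 the parity test computes, so `q m 2` reduces to `a m 1`.
  (a[m,1] m)
  (λ c w≤2 n∣ → combination≡0⇒free (λ i → ℕ.m≤n+m 1 (toℕ i)) inj c w≤2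
    (small-combination m c f≤m 2m<n w≤2 n∣))
  where
  2m<n : 2 * m < 2 * m + 1
  2m<n = ℕ.m<m+n (2 * m) z<s

  inj : Injective _≡_ _≡_ (λ (i : Fin m) → toℕ i + 1)
  inj = Fin.toℕ-injective ∘ ℕ.+-cancelʳ-≡ 1 _ _

  f≤m : ∀ (i : Fin m) → toℕ i + 1 ≤ m
  f≤m i = subst (_≤ m) (ℕ.+-comm 1 (toℕ i)) (Fin.toℕ<n i)

-- A relation with odd coefficients of weight at most 3 and even value has
-- even weight, hence weight at most 2.
tight₃ : ∀ k → IsTightIndependent (ℤ/ (4 * suc k)) 3
  (residues (4 * suc k) (map (λ i → 2 * i + 1) (upTo (suc k))))
tight₃ k = tight f
  (∈-tabulated⁺ (λ i → 2 * i + 1)) (∈-tabulated⁻ (λ i → 2 * i + 1)) inj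
  (λ i → ℕ.≤-<-trans (f≤M i) (ℕ.≤-<-trans (ℕ.m≤m+n M _) 2M<n))
  (trans (cong₂ _+_ (a[m,1] (suc k)) (a[m,1] k)) (n≡ k))
  (λ c w≤3 n∣ → let w≤2 = even⇒≤2 w≤3 (even-weight c n∣) in
    combination≡0⇒free (λ i → ℕ.m≤n+m 1 _) inj c w≤2
      (small-combination M c f≤M 2M<n w≤2 n∣))
  where
  f : Fin (suc k) → ℕ
  f i = 2 * toℕ i + 1

  -- The largest element. Twice it is n - 2, while three times it exceeds n as soon as k ≥ 1, which
  -- is why the weight has to drop to 2.
  M = 2 * k + 1

  n≡ : ∀ k → (2 * (1 + k) + 1) + (2 * k + 1) ≡ 4 * (1 + k)
  n≡ = solve-∀

  2M+2≡n : ∀ k → 2 + 2 * (2 * k + 1) ≡ 4 * (1 + k)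
  2M+2≡n = solve-∀

  2M<n : 2 * M < 4 * suc k
  2M<n = subst (2 * M <_) (2M+2≡n k) (ℕ.m<n+m (2 * M) {2} z<s)

  inj : Injective _≡_ _≡_ f
  inj = Fin.toℕ-injective ∘ ℕ.*-cancelˡ-≡ _ _ 2 ∘ ℕ.+-cancelʳ-≡ 1 _ _

  f≤M : ∀ i → f i ≤ M
  f≤M i = ℕ.+-monoˡ-≤ 1 (ℕ.*-monoʳ-≤ 2 (Fin.toℕ≤pred[n] i))

  2∣n : + 2 ∣ℤ + (4 * suc k)
  2∣n = ℤ∣.∣ᵤ⇒∣ (divides (2 * suc k) (4k≡ (suc k)))
    where
    4k≡ : ∀ k → 4 * k ≡ 2 * k * 2
    4k≡ = solve-∀

  even-weight : ∀ c → + (4 * suc k) ∣ℤ combination c f → 2 ∣ weight c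
  even-weight c n∣ = ℤ∣.∣⇒∣ᵤ $ subst (+ 2 ∣ℤ_) (cancel (combination c f) (+ weight c)) $
    ℤ∣.∣m∣n⇒∣m-n (ℤ∣.∣-trans 2∣n n∣) (odd-combination c toℕ)
    where
    cancel : ∀ x y → x ℤ.- (x ℤ.- y) ≡ y
    cancel = solve-∀ℤ

  even⇒≤2 : ∀ {w} → w ≤ 3 → 2 ∣ w → w ≤ 2
  even⇒≤2 w≤3 2∣w = ℕ.≤-pred (ℕ.≤∧≢⇒< w≤3 λ { refl → 2∤1+s*2 1 2∣w })

-- The value of a relation is its only coefficient, too small to be a nonzero multiple of t + 1. The
-- list `xs` may repeat the entry 1, so that {1, t} with t = 1 is covered as well.
tight-singleton : ∀ t .{{_ : NonZero t}} .{{_ : NonZero (t + 1)}} {xs} →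
  1 ∈ xs → (∀ {v} → v ∈ xs → v ≡ 1) →
  IsTightIndependent (ℤ/ (t + 1)) t (residues (t + 1) xs)
tight-singleton t 1∈ only = tight {m = 1} (λ _ → 1)
  (λ _ → 1∈) (λ v∈ → zero , only v∈) (λ { {zero} {zero} _ → refl })
  (λ _ → ℕ.m<n+m 1 (>-nonZero⁻¹ t))
  (q[1,t] t)
  (λ { c w≤t n∣ zero → trans (value (c zero)) $
    small-combination 1 c (λ _ → ℕ.≤-refl)
      (subst (_< t + 1) (sym (ℕ.*-identityʳ t)) (ℕ.m<m+n t z<s)) w≤t n∣ })
  where
  value : ∀ x → x ≡ x ℤ.* + 1 ℤ.+ 0ℤ
  value = solve-∀ℤ

-- In both two-element cases the weight of a relation with value 0 turns out to be a multiple of t +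
-- 1, yet it is at most t.
m*1+n≤n⇒m≡0 : ∀ {m n} → m * suc n ≤ n → m ≡ 0
m*1+n≤n⇒m≡0 {m} {n} p = ℕ.n<1⇒n≡0 $ ℕ.*-cancelʳ-< (suc n) m 1 $
  subst (m * suc n <_) (sym (ℕ.*-identityˡ (suc n))) (s≤s p)

lookup-pair-injective : ∀ {x y : ℕ} → x ≢ y → Injective _≡_ _≡_ (lookup (x ∷ y ∷ []))
lookup-pair-injective x≢y {zero}     {zero}     _ = refl
lookup-pair-injective x≢y {zero}     {suc zero} p = contradiction p x≢y
lookup-pair-injective x≢y {suc zero} {zero}     p = contradiction (sym p) x≢y
lookup-pair-injective x≢y {suc zero} {suc zero} _ = refl

-- A vanishing x s + y (s + 1) has (x , y) = ((x + y) (s + 1) , − (x + y) s).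
tight-even : ∀ s .{{_ : NonZero (s * 2)}} .{{_ : NonZero (1 + (s * s + s) * 2)}} →
  let n = 1 + (s * s + s) * 2 in
  IsTightIndependent (ℤ/ n) (s * 2) (residues n (s ∷ s + 1 ∷ []))
tight-even s = tight (lookup (s ∷ s + 1 ∷ []))
  ∈-lookup (∈-lookup⁻ _) (lookup-pair-injective (ℕ.<⇒≢ (ℕ.m<m+n s z<s)))
  (λ i → ℕ.≤-<-trans (f≤M i) (ℕ.≤-<-trans (ℕ.m≤n*m (s + 1) (s * 2)) tM<n))
  (trans (q-even 2 s) (a[2,s] s))
  (λ c w≤t n∣ → let c≡0 = kernel (c zero) (c (suc zero)) w≤t
                            (small-combination (s + 1) c f≤M tM<n w≤t n∣) in
    λ { zero → proj₁ c≡0 ; (suc zero) → proj₂ c≡0 })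
  where
  f≤M : ∀ i → lookup (s ∷ s + 1 ∷ []) i ≤ s + 1
  f≤M zero       = ℕ.m≤m+n s 1
  f≤M (suc zero) = ℕ.≤-refl

  tM≡ : ∀ s → s * 2 * (s + 1) ≡ (s * s + s) * 2
  tM≡ = solve-∀

  -- Here t (s + 1) is exactly n - 1, so the size bound holds with nothing to spare.
  tM<n : s * 2 * (s + 1) < 1 + (s * s + s) * 2
  tM<n = s≤s (ℕ.≤-reflexive (tM≡ s))

  x≡ : ∀ x y s → x ≡ (x ℤ.+ y) ℤ.* (s ℤ.+ + 1) ℤ.- (x ℤ.* s ℤ.+ (y ℤ.* (s ℤ.+ + 1) ℤ.+ 0ℤ))
  x≡ = solve-∀ℤ

  y≡ : ∀ x y s → y ≡ (x ℤ.* s ℤ.+ (y ℤ.* (s ℤ.+ + 1) ℤ.+ 0ℤ)) ℤ.- (x ℤ.+ y) ℤ.* s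
  y≡ = solve-∀ℤ

  weight≡ : ∀ k s → k * (s + 1) + (k * s + 0) ≡ k * (1 + s * 2)
  weight≡ = solve-∀

  kernel : ∀ x y → ∣ x ∣ + (∣ y ∣ + 0) ≤ s * 2 →
    x ℤ.* + s ℤ.+ (y ℤ.* + (s + 1) ℤ.+ 0ℤ) ≡ 0ℤ → x ≡ 0ℤ × y ≡ 0ℤ
  kernel x y w≤t S≡0 =
    ℤ.∣i∣≡0⇒i≡0 (trans ∣x∣≡ (cong (_* (s + 1)) k≡0)) ,
    ℤ.∣i∣≡0⇒i≡0 (trans ∣y∣≡ (cong (_* s) k≡0))
    where
    k = x ℤ.+ y
    S = x ℤ.* + s ℤ.+ (y ℤ.* + (s + 1) ℤ.+ 0ℤ)

    ∣x∣≡ : ∣ x ∣ ≡ ∣ k ∣ * (s + 1)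
    ∣x∣≡ = begin
      ∣ x ∣                            ≡⟨ cong ∣_∣ (x≡ x y (+ s)) ⟩
      ∣ k ℤ.* + (s + 1) ℤ.- S ∣        ≡⟨ cong (λ S → ∣ k ℤ.* + (s + 1) ℤ.- S ∣) S≡0 ⟩
      ∣ k ℤ.* + (s + 1) ℤ.- 0ℤ ∣       ≡⟨ cong ∣_∣ (ℤ.+-identityʳ (k ℤ.* + (s + 1))) ⟩
      ∣ k ℤ.* + (s + 1) ∣              ≡⟨ ℤ.abs-* k (+ (s + 1)) ⟩
      ∣ k ∣ * (s + 1)                  ∎
      where open ≡-Reasoning

    ∣y∣≡ : ∣ y ∣ ≡ ∣ k ∣ * s
    ∣y∣≡ = begin
      ∣ y ∣                            ≡⟨ cong ∣_∣ (y≡ x y (+ s)) ⟩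
      ∣ S ℤ.- k ℤ.* + s ∣              ≡⟨ cong (λ S → ∣ S ℤ.- k ℤ.* + s ∣) S≡0 ⟩
      ∣ 0ℤ ℤ.- k ℤ.* + s ∣             ≡⟨ cong ∣_∣ (ℤ.+-identityˡ (ℤ.- (k ℤ.* + s))) ⟩
      ∣ ℤ.- (k ℤ.* + s) ∣              ≡⟨ ℤ.∣-i∣≡∣i∣ (k ℤ.* + s) ⟩
      ∣ k ℤ.* + s ∣                    ≡⟨ ℤ.abs-* k (+ s) ⟩
      ∣ k ∣ * s                        ∎
      where open ≡-Reasoning

    k≡0 : ∣ k ∣ ≡ 0
    k≡0 = m*1+n≤n⇒m≡0 $ subst (_≤ s * 2)
      (trans (cong₂ (λ u v → u + (v + 0)) ∣x∣≡ ∣y∣≡) (weight≡ ∣ k ∣ s)) w≤t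

-- With y = s + 1 − d, the value n is attained at x = s + 1 + t d, and then
-- x + y > t if d ≥ 0 while y − x > t if d < 0.
value-n-heavy : ∀ s x y → let t = suc (s * 2) in
  ∣ x ∣ + ∣ y ∣ ≤ t → x ℤ.+ y ℤ.* + t ≢ + (suc s * suc s * 2)
value-n-heavy s x y w≤t S≡n = by-sign (+ suc s ℤ.- y) refl
  where
  open ℕ.≤-Reasoning

  N≡ : + (suc s * suc s * 2) ≡ (+ 1 ℤ.+ + s) ℤ.* (+ 1 ℤ.+ + s) ℤ.* + 2
  N≡ = trans (ℤ.pos-* (suc s * suc s) 2) (cong (ℤ._* + 2) (ℤ.pos-* (suc s) (suc s)))

  S≡N : x ℤ.+ y ℤ.* (+ 1 ℤ.+ + s ℤ.* + 2) ≡ (+ 1 ℤ.+ + s) ℤ.* (+ 1 ℤ.+ + s) ℤ.* + 2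
  S≡N = trans (cong (λ t → x ℤ.+ y ℤ.* (+ 1 ℤ.+ t)) (sym (ℤ.pos-* s 2))) (trans S≡n N≡)

  -- The value minus n, plus a remainder linear in d = s + 1 - y. The first part cancels by `S≡N`;
  -- `diff≡` has the same shape.
  sum≡ : ∀ x y s → x ℤ.+ y ≡
    (x ℤ.+ y ℤ.* (+ 1 ℤ.+ s ℤ.* + 2)) ℤ.- (+ 1 ℤ.+ s) ℤ.* (+ 1 ℤ.+ s) ℤ.* + 2
    ℤ.+ (+ 2 ℤ.+ s ℤ.* + 2 ℤ.+ s ℤ.* + 2 ℤ.* ((+ 1 ℤ.+ s) ℤ.- y))
  sum≡ = solve-∀ℤ

  diff≡ : ∀ x y s → x ℤ.- y ≡
    (x ℤ.+ y ℤ.* (+ 1 ℤ.+ s ℤ.* + 2)) ℤ.- (+ 1 ℤ.+ s) ℤ.* (+ 1 ℤ.+ s) ℤ.* + 2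
    ℤ.+ (+ 2 ℤ.+ s ℤ.* + 2) ℤ.* ((+ 1 ℤ.+ s) ℤ.- y)
  diff≡ = solve-∀ℤ

  cancel : ∀ {u v} w → u ≡ v → u ℤ.- v ℤ.+ w ≡ w
  cancel {u} w refl = trans (cong (ℤ._+ w) (ℤ.+-inverseʳ u)) (ℤ.+-identityˡ w)

  by-sign : ∀ d → + suc s ℤ.- y ≡ d → ⊥
  by-sign (+ e) d≡ = ℕ.<⇒≱ (begin-strict
    suc (s * 2)                  <⟨ ℕ.m≤m+n (2 + s * 2) (s * 2 * e) ⟩
    2 + s * 2 + s * 2 * e        ≡⟨ cong ∣_∣ x+y≡ ⟨
    ∣ x ℤ.+ y ∣                  ≤⟨ ℤ.∣i+j∣≤∣i∣+∣j∣ x y ⟩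
    ∣ x ∣ + ∣ y ∣                ∎) w≤t
    where
    x+y≡ : x ℤ.+ y ≡ + (2 + s * 2 + s * 2 * e)
    x+y≡ = trans (sum≡ x y (+ s)) (trans (cancel _ S≡N) (trans
      (cong (λ d → + 2 ℤ.+ + s ℤ.* + 2 ℤ.+ + s ℤ.* + 2 ℤ.* d) d≡)
      (sym (cong₂ (λ u v → + 2 ℤ.+ u ℤ.+ v) (ℤ.pos-* s 2)
        (trans (ℤ.pos-* (s * 2) e) (cong (ℤ._* + e) (ℤ.pos-* s 2)))))))
  by-sign -[1+ e ] d≡ = ℕ.<⇒≱ (begin-strict
    suc (s * 2)                        <⟨ ℕ.m≤m*n (2 + s * 2) (suc e) ⟩
    (2 + s * 2) * suc e                ≡⟨ ℤ.abs-* (+ (2 + s * 2)) -[1+ e ] ⟨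
    ∣ + (2 + s * 2) ℤ.* -[1+ e ] ∣     ≡⟨ cong ∣_∣ x-y≡ ⟨
    ∣ x ℤ.- y ∣                        ≤⟨ ℤ.∣i-j∣≤∣i∣+∣j∣ x y ⟩
    ∣ x ∣ + ∣ y ∣                      ∎) w≤t
    where
    x-y≡ : x ℤ.- y ≡ + (2 + s * 2) ℤ.* -[1+ e ]
    x-y≡ = trans (diff≡ x y (+ s)) (trans (cancel _ S≡N)
      (cong₂ (λ u d → (+ 2 ℤ.+ u) ℤ.* d) (sym (ℤ.pos-* s 2)) d≡))

-- Since t² < 2n, a relation has value 0 or ± n. Value 0 gives |x| = |y| t and hence weight |y| (t +
-- 1); the values ± n are excluded by `value-n-heavy`. Taking `s = suc k` makes t at least 3, so 1
-- and t are distinct.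
tight-odd : ∀ k → let s = suc k; t = suc (s * 2); n = suc s * suc s * 2 in
  IsTightIndependent (ℤ/ n) t (residues n (1 ∷ t ∷ []))
tight-odd k = tight (lookup (1 ∷ t ∷ []))
  ∈-lookup (∈-lookup⁻ _) (lookup-pair-injective λ ())
  (λ i → ℕ.≤-<-trans (f≤t i) t<n)
  (trans (q-odd 2 s) (trans (cong₂ _+_ (a[2,s] s) (a[1,s] s)) (n≡ s)))
  (λ c w≤t n∣ → let c≡0 = kernel (c zero) (c (suc zero))
                            (subst (_≤ t) (cong (λ w → ∣ c zero ∣ + w) (ℕ.+-identityʳ _)) w≤t)
                            (value≤ c w≤t)
                            (subst (+ n ∣ℤ_) (value (c zero) (c (suc zero)) (+ t)) n∣) in
    λ { zero → proj₁ c≡0 ; (suc zero) → proj₂ c≡0 })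
  where
  s = suc k
  t = suc (s * 2)
  n = suc s * suc s * 2

  n≡ : ∀ s → 1 + (s * s + s) * 2 + (1 + s * 2) ≡ (1 + s) * (1 + s) * 2
  n≡ = solve-∀

  f≤t : ∀ i → lookup (1 ∷ t ∷ []) i ≤ t
  f≤t zero       = s≤s z≤n
  f≤t (suc zero) = ℕ.≤-refl

  value : ∀ x y t → x ℤ.* + 1 ℤ.+ (y ℤ.* t ℤ.+ 0ℤ) ≡ x ℤ.+ y ℤ.* t
  value = solve-∀ℤ

  t<n : t < n
  t<n = subst (t <_) (n≡ s) (ℕ.m<n+m t {suc ((s * s + s) * 2)} z<s)

  t*t<2*n : t * t < 2 * n
  -- The gap 2n - t² is 4s + 3.
  t*t<2*n = subst (t * t <_) (expand s) (ℕ.m<m+n (t * t) z<s)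
    where
    expand : ∀ s → (1 + s * 2) * (1 + s * 2) + (3 + s * 4) ≡ 2 * ((1 + s) * (1 + s) * 2)
    expand = solve-∀

  kernel : ∀ x y → ∣ x ∣ + ∣ y ∣ ≤ t → ∣ x ℤ.+ y ℤ.* + t ∣ ≤ t * t →
    + n ∣ℤ x ℤ.+ y ℤ.* + t → x ≡ 0ℤ × y ≡ 0ℤ
  kernel x y w≤t S≤tt (ℤ∣.divides j S≡jn) = by-quotient j S≡jn ∣j∣<2
    where
    ∣j∣<2 : ∣ j ∣ < 2
    ∣j∣<2 = ℕ.*-cancelʳ-< n ∣ j ∣ 2 $ ℕ.≤-<-trans
      (subst (_≤ t * t) (trans (cong ∣_∣ S≡jn) (ℤ.abs-* j (+ n))) S≤tt) t*t<2*n

    negate : ∀ x y t → ℤ.- x ℤ.+ ℤ.- y ℤ.* t ≡ ℤ.- (x ℤ.+ y ℤ.* t)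
    negate = solve-∀ℤ

    isolate : ∀ x z → x ≡ (x ℤ.+ z) ℤ.- z
    isolate = solve-∀ℤ

    by-quotient : ∀ j → x ℤ.+ y ℤ.* + t ≡ j ℤ.* + n → ∣ j ∣ < 2 → x ≡ 0ℤ × y ≡ 0ℤ
    by-quotient (+ 0) S≡0 _ =
      ℤ.∣i∣≡0⇒i≡0 (trans ∣x∣≡ (cong (_* t) ∣y∣≡0)) , ℤ.∣i∣≡0⇒i≡0 ∣y∣≡0
      where
      ∣x∣≡ : ∣ x ∣ ≡ ∣ y ∣ * t
      ∣x∣≡ = begin
        ∣ x ∣                              ≡⟨ cong ∣_∣ (isolate x (y ℤ.* + t)) ⟩
        ∣ x ℤ.+ y ℤ.* + t ℤ.- y ℤ.* + t ∣  ≡⟨ cong (λ S → ∣ S ℤ.- y ℤ.* + t ∣) S≡0 ⟩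
        ∣ 0ℤ ℤ.- y ℤ.* + t ∣               ≡⟨ cong ∣_∣ (ℤ.+-identityˡ (ℤ.- (y ℤ.* + t))) ⟩
        ∣ ℤ.- (y ℤ.* + t) ∣                ≡⟨ ℤ.∣-i∣≡∣i∣ (y ℤ.* + t) ⟩
        ∣ y ℤ.* + t ∣                      ≡⟨ ℤ.abs-* y (+ t) ⟩
        ∣ y ∣ * t                          ∎
        where open ≡-Reasoning

      ∣y∣≡0 : ∣ y ∣ ≡ 0
      ∣y∣≡0 = m*1+n≤n⇒m≡0 $ subst (_≤ t)
        (trans (cong (_+ ∣ y ∣) ∣x∣≡) (trans (ℕ.+-comm _ ∣ y ∣) (sym (ℕ.*-suc ∣ y ∣ t)))) w≤t
    by-quotient (+ 1) S≡n _ =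
      contradiction (trans S≡n (ℤ.*-identityˡ (+ n))) (value-n-heavy s x y w≤t)
    -- Changing the signs of `x` and `y` turns the value - n into n and keeps the weight.
    by-quotient -[1+ 0 ] S≡-n _ = contradiction
      (trans (negate x y (+ t)) (trans (cong ℤ.-_ S≡-n)
        (trans (ℤ.neg-distribˡ-* -[1+ 0 ] (+ n)) (ℤ.*-identityˡ (+ n)))))
      (value-n-heavy s (ℤ.- x) (ℤ.- y)
        (subst₂ (λ u v → u + v ≤ t) (sym (ℤ.∣-i∣≡∣i∣ x)) (sym (ℤ.∣-i∣≡∣i∣ y)) w≤t))
    by-quotient (+ suc (suc _)) _ (s≤s (s≤s ()))
    by-quotient -[1+ suc _ ]    _ (s≤s (s≤s ()))

  value≤ : ∀ c → weight c ≤ t →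
    ∣ c zero ℤ.+ c (suc zero) ℤ.* + t ∣ ≤ t * t
  value≤ c w≤t = subst (λ S → ∣ S ∣ ≤ t * t) (value (c zero) (c (suc zero)) (+ t))
    (ℕ.≤-trans (∣combination∣≤ t c f≤t) (ℕ.*-monoˡ-≤ t w≤t))

-- Exhaustive search for the set {1, 7, 11} modulo 38.

∀∣x∣≤? : ∀ {ℓ} {P : Pred ℤ ℓ} b → Decidable P → Dec (∀ x → ∣ x ∣ ≤ b → P x)
-- An integer of absolute value at most `b` is i or - i for some i from 0 to `b`, so a search over
-- `Fin (suc b)` testing both signs suffices.
∀∣x∣≤? {P = P} b P? = map′ from to (Fin.all? λ (i : Fin (suc b)) → P? (+ toℕ i) ×-dec P? (ℤ.- + toℕ i))
  where
  from : (∀ (i : Fin (suc b)) → P (+ toℕ i) × P (ℤ.- + toℕ i)) → ∀ x → ∣ x ∣ ≤ b → P x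
  from all x x≤b with all (fromℕ< (s≤s x≤b))
  ... | p⁺ , p⁻ rewrite Fin.toℕ-fromℕ< (s≤s x≤b) with ℤ.+∣i∣≡i⊎+∣i∣≡-i x
  ... | inj₁ eq = subst P eq p⁺
  ... | inj₂ eq = subst P (trans (cong ℤ.-_ eq) (ℤ.neg-involutive x)) p⁻

  to : (∀ x → ∣ x ∣ ≤ b → P x) → ∀ (i : Fin (suc b)) → P (+ toℕ i) × P (ℤ.- + toℕ i)
  to all i = all _ (Fin.toℕ≤pred[n] i) ,
    all _ (subst (_≤ b) (sym (ℤ.∣-i∣≡∣i∣ (+ toℕ i))) (Fin.toℕ≤pred[n] i))

-- Each coefficient is bounded separately, as the total weight 5 allows, so every quantifier has a
-- finite range and the whole statement is decided by evaluation.
no-relation₃₈ : ∀ x → ∣ x ∣ ≤ 5 → ∀ y → ∣ y ∣ ≤ 5 → ∀ z → ∣ z ∣ ≤ 5 →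
  ∣ x ∣ + (∣ y ∣ + (∣ z ∣ + 0)) ≤ 5 →
  38 ∣ ∣ x ℤ.* + 1 ℤ.+ (y ℤ.* + 7 ℤ.+ (z ℤ.* + 11 ℤ.+ 0ℤ)) ∣ →
  x ≡ 0ℤ × y ≡ 0ℤ × z ≡ 0ℤ
no-relation₃₈ = toWitness {a? =
  ∀∣x∣≤? 5 λ x → ∀∣x∣≤? 5 λ y → ∀∣x∣≤? 5 λ z →
    (∣ x ∣ + (∣ y ∣ + (∣ z ∣ + 0)) ℕ.≤? 5) →-dec
    (38 ∣? ∣ x ℤ.* + 1 ℤ.+ (y ℤ.* + 7 ℤ.+ (z ℤ.* + 11 ℤ.+ 0ℤ)) ∣) →-dec
    ((x ℤ.≟ 0ℤ) ×-dec (y ℤ.≟ 0ℤ) ×-dec (z ℤ.≟ 0ℤ))} tt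

tight₃₈ : IsTightIndependent (ℤ/ 38) 5 (residues 38 (1 ∷ 7 ∷ 11 ∷ []))
tight₃₈ = tight f ∈-lookup (∈-lookup⁻ _)
  (λ {i} {j} → toWitness {a? = Fin.all? λ i → Fin.all? λ j → (f i ℕ.≟ f j) →-dec (i Fin.≟ j)} tt i j)
  -- The last argument is the computation of `q 3 5` as 25 + 13 = 38.
  (toWitness {a? = Fin.all? λ i → f i ℕ.<? 38} tt) refl
  λ c w≤5 n∣ →
    let bound i = ℕ.≤-trans (term≤sum (λ i → ∣ c i ∣) i) w≤5
        x≡0 , y≡0 , z≡0 = no-relation₃₈ (c zero) (bound zero) (c (suc zero)) (bound (suc zero))
                            (c (suc (suc zero))) (bound (suc (suc zero))) w≤5 (ℤ∣.∣⇒∣ᵤ n∣)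
    in λ { zero → x≡0 ; (suc zero) → y≡0 ; (suc (suc zero)) → z≡0 }
  where
  f = lookup (1 ∷ 7 ∷ 11 ∷ [])

-- The order ⌊t²/2⌋ + t + 1 by parity of t, and assembly of the claims.

order-even : ∀ s → (s * 2) ^ 2 / 2 + s * 2 + 1 ≡ 1 + (s * s + s) * 2
order-even s = trans
  (cong (λ k → k + s * 2 + 1) (trans (cong (_/ 2) (square s)) (m*n/n≡m (s * s * 2) 2)))
  (collect s)
  where
  square : ∀ s → s * 2 * (s * 2 * 1) ≡ s * s * 2 * 2
  square = solve-∀

  collect : ∀ s → s * s * 2 + s * 2 + 1 ≡ 1 + (s * s + s) * 2
  collect = solve-∀

order-odd : ∀ s → suc (s * 2) ^ 2 / 2 + suc (s * 2) + 1 ≡ suc s * suc s * 2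
order-odd s = trans (cong (λ k → k + suc (s * 2) + 1) half) (collect s)
  where
  h = (s * s + s) * 2

  square : ∀ s → (1 + s * 2) * ((1 + s * 2) * 1) ≡ 1 + (s * s + s) * 2 * 2
  square = solve-∀

  -- The square of t is 1 + 2h, and halving discards the 1.
  half : suc (s * 2) ^ 2 / 2 ≡ h
  half = trans (cong (_/ 2) (square s))
    (trans (+-distrib-/-∣ʳ 1 {d = 2} (divides h refl)) (m*n/n≡m h 2))

  collect : ∀ s → (s * s + s) * 2 + (1 + s * 2) + 1 ≡ (1 + s) * (1 + s) * 2
  collect = solve-∀

tight-two-even : ∀ t .{{_ : NonZero t}} .{{_ : NonZero (t ^ 2 / 2 + t + 1)}} → 2 ∣ t →
  let n = t ^ 2 / 2 + t + 1 in
  IsTightIndependent (ℤ/ n) t (residues n (t / 2 ∷ t / 2 + 1 ∷ []))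
tight-two-even t (divides s refl) rewrite order-even s | m*n/n≡m s 2 {{_}} = tight-even s

tight-two-odd : ∀ t .{{_ : NonZero t}} .{{_ : NonZero (t ^ 2 / 2 + t + 1)}} → ¬ 2 ∣ t →
  let n = t ^ 2 / 2 + t + 1 in
  IsTightIndependent (ℤ/ n) t (residues n (1 ∷ t ∷ []))
tight-two-odd t 2∤t with even⊎odd t
... | inj₁ (s , refl) = contradiction (divides s refl) 2∤t
-- For t = 1 the order is 2 = t + 1 and the list 1, t repeats a single element, so the singleton
-- case applies.
... | inj₂ (zero , refl) =
  tight-singleton 1 (here refl) λ { (here p) → p ; (there (here p)) → p }
... | inj₂ (suc k , refl) rewrite order-odd (suc k) = tight-odd k

proposition13 : (m n t : ℕ) .{{_ : NonZero m}} .{{_ : NonZero n}} .{{_ : NonZero t}} →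
    (n ≡ 2 → IsTightIndependent (ℤ/ n) 1 (residues n (1 ∷ [])))
    × (n ≡ 2 * m + 1 → IsTightIndependent (ℤ/ n) 2 (residues n (map (λ i → i + 1) (upTo m))))
    × (n ≡ 4 * m → IsTightIndependent (ℤ/ n) 3 (residues n (map (λ i → 2 * i + 1) (upTo m))))
    × (n ≡ t + 1 → IsTightIndependent (ℤ/ n) t (residues n (1 ∷ [])))
    × (n ≡ t ^ 2 / 2 + t + 1 →
        (2 ∣ t → IsTightIndependent (ℤ/ n) t (residues n (t / 2 ∷ t / 2 + 1 ∷ [])))
        × (¬ (2 ∣ t) → IsTightIndependent (ℤ/ n) t (residues n (1 ∷ t ∷ []))))
    × (n ≡ 38 → IsTightIndependent (ℤ/ n) 5 (residues n (1 ∷ 7 ∷ 11 ∷ [])))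
proposition13 zero n t = contradiction refl (≢-nonZero⁻¹ 0)
proposition13 m@(suc k) n t =
  -- The order 2 is t + 1 at t = 1, so this is an instance of the claim for general t.
  (λ { refl → tight-singleton 1 (here refl) only₁ }) ,
  (λ { refl → tight₂ m }) ,
  (λ { refl → tight₃ k }) ,
  (λ { refl → tight-singleton t (here refl) only₁ }) ,
  (λ { refl → tight-two-even t , tight-two-odd t }) ,
  (λ { refl → tight₃₈ })
  where
  only₁ : ∀ {v} → v ∈ 1 ∷ [] → v ≡ 1
  only₁ (here p) = p
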